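{- The following equalities of sets of one-sided infinite binary words hold: $$G_{01}=01\bullet W,$$ $$G_{001}=0\,\delta\big((01)^{ -1}G_{01}\cup G_{001}\big),$$ $$G_{0001}=\delta(G_{1}),$$ $$G_{1}=0^{ -1}G_{01}.$$
   Context: A factor of a word is a finite contiguous subword. A word $w$ encounters a pattern $p\in\{0,1\}^*$ if $g(p)$ is a factor of $w$ for some non-erasing morphism $g:\{0,1\}^*\to\{0,1\}^*$ (i.e. $g(0),g(1)$ non-empty). A (finite or one-sided infinite) binary word is good if it contains neither $11$ nor $1001$ as a factor, and encounters neither of the patterns $0000$ and $00010100$. Let $\delta$ be the morphism with $\delta(0)=01$, $\delta(1)=00$, extended to infinite words. $G$ is the set of one-sided infinite good words, and for $w\in\{0,1\}^*$, $G_w=G\cap w\{0,1\}^\omega$ is the set of those with prefix $w$. For a set $L$ of infinite words and a finite word $x$: $x^{ -1}L=\{\mathbf{y}:x\mathbf{y}\in L\}$, $\delta(L)=\{\delta(\mathbf{y}):\mathbf{y}\in L\}$, and $xL=\{x\mathbf{y}:\mathbf{y}\in L\}$. Operators. Suppose a finite binary word $w$ has a suffix $\delta^n(01)$ for some $n\ge 0$; let $n$ be as large as possible and write $w=y\,\delta^n(01)$. Define $\alpha(w)=w\,\delta^n(00)=y\,\delta^{n+1}(01)$, $\beta(w)=w\,\delta^n(0100)=y\,\delta^{n+1}(001)$, $\gamma(w)=w\,\delta^n(010100)=y\,\delta^{n+1}(0001)$. Let $B=\{\alpha,\beta,\gamma\}$. For $\mathbf{f}=f_1f_2f_3\cdots\in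 B^\omega$ and such a $w$, the word $w$ is a proper prefix of $f_1(w)$, which is a proper prefix of $f_2(f_1(w))$, and so on; $w\bullet\mathbf{f}$ denotes the one-sided infinite word having all of $f_n(f_{n-1}(\cdots f_1(w)\cdots))$, $n\ge1$, as prefixes. Let $W=\{\mathbf{f}\in B^\omega:01\bullet\mathbf{f}\in G\}$ and $01\bullet W=\{01\bullet\mathbf{f}:\mathbf{f}\in W\}$. -}

module Defs where

open import Level using (0ℓ)
open import Data.Bool using (Bool; true; false)
import Data.Bool.Properties as Bool
open import Data.Empty using (⊥-elim)
open import Data.Fin using (fromℕ<)
open import Data.Fin.Patterns using (0F; 1F)
open import Data.List using (List; []; _∷_; _++_; length; lookup; concatMap; applyUpTo)
open import Data.List.Properties using (length-++; ++-assoc; ++-identityʳ)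
open import Data.List.Relation.Binary.Suffix.Heterogeneous using (Suffix; here; there)
open import Data.List.Relation.Binary.Suffix.Heterogeneous.Properties
  using (suffix?; length-mono)
open import Data.Nat using (ℕ; zero; suc; _+_; _≤_; _<_; z≤n; s≤s)
open import Data.Nat.Properties
open import Data.Product using (_×_; _,_; ∃; ∃-syntax; proj₁; proj₂)
open import Data.Sum using (inj₁; inj₂)
open import Data.Vec as Vec using (Vec; []; _∷_)
open import Function using (_∘_)
open import Relation.Binary.PropositionalEquality
open import Relation.Nullary using (¬_; Dec; yes; no)
open import Relation.Unary using (Pred; _∩_; U)

Letter : Set
Letter = Bool

pattern 𝟘 = false
pattern 𝟙 = true

Word : Set
Word = List Letter

-- Two infinite words are identified when they agree pointwise (_≗_).
InfWord : Set
InfWord = ℕ → Letter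

infixr 5 _++ω_

_++ω_ : Word → InfWord → InfWord
([]      ++ω y) n       = y n
((a ∷ u) ++ω y) zero    = a
((a ∷ u) ++ω y) (suc n) = (u ++ω y) n

_FactorOf_ : Word → InfWord → Set
u FactorOf x = ∃[ i ] applyUpTo (λ k → x (i + k)) (length u) ≡ u

-- A morphism of free monoids is given by its values g on letters; its
-- extension to words is concatMap g.
NonErasing : (Letter → Word) → Set
NonErasing g = ∀ a → g a ≢ []

_Encounters_ : InfWord → Word → Set
x Encounters p = ∃[ g ] NonErasing g × (concatMap g p FactorOf x)

Good : Pred InfWord 0ℓ
Good x = ¬ ((𝟙 ∷ 𝟙 ∷ []) FactorOf x)
       × ¬ ((𝟙 ∷ 𝟘 ∷ 𝟘 ∷ 𝟙 ∷ []) FactorOf x)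
       × ¬ (x Encounters (𝟘 ∷ 𝟘 ∷ 𝟘 ∷ 𝟘 ∷ []))
       × ¬ (x Encounters (𝟘 ∷ 𝟘 ∷ 𝟘 ∷ 𝟙 ∷ 𝟘 ∷ 𝟙 ∷ 𝟘 ∷ 𝟘 ∷ []))

δ-letter : Letter → Vec Letter 2
δ-letter 𝟘 = 𝟘 ∷ 𝟙 ∷ []
δ-letter 𝟙 = 𝟘 ∷ 𝟘 ∷ []

δ : Word → Word
δ = concatMap (Vec.toList ∘ δ-letter)

δ^ : ℕ → Word → Word
δ^ zero    u = u
δ^ (suc n) u = δ (δ^ n u)

δω : InfWord → InfWord
δω y zero          = Vec.lookup (δ-letter (y 0)) 0F
δω y (suc zero)    = Vec.lookup (δ-letter (y 0)) 1F
δω y (suc (suc n)) = δω (y ∘ suc) n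

infixr 7 _·_ _⁻¹·_

_·_ : Word → Pred InfWord 0ℓ → Pred InfWord 0ℓ
(x · L) z = ∃[ y ] L y × z ≗ (x ++ω y)

_⁻¹·_ : Word → Pred InfWord 0ℓ → Pred InfWord 0ℓ
(x ⁻¹· L) y = L (x ++ω y)

δ[_] : Pred InfWord 0ℓ → Pred InfWord 0ℓ
δ[ L ] z = ∃[ y ] L y × z ≗ δω y

G : Pred InfWord 0ℓ
G = Good

G[_] : Word → Pred InfWord 0ℓ
G[ w ] = G ∩ (w · U)

01-word : Word
01-word = 𝟘 ∷ 𝟙 ∷ []

_SuffixOf_ : Word → Word → Set
_SuffixOf_ = Suffix _≡_

_SuffixOf?_ : ∀ u w → Dec (u SuffixOf w)
_SuffixOf?_ = suffix? Bool._≟_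

private
  largest : Word → ℕ → ℕ
  largest w zero = zero
  largest w (suc k) with δ^ (suc k) 01-word SuffixOf? w
  ... | yes _ = suc k
  ... | no  _ = largest w k

-- The largest n such that δⁿ(01) is a suffix of w (see level-suffix and
-- level-largest); the search bound suffices because |δⁿ(01)| ≥ n. The value
-- is a dummy 0 if there is no such n.
level : Word → ℕ
level w = largest w (length w)

private
  largest-spec : ∀ w k n → n ≤ k → δ^ n 01-word SuffixOf w →
                 (δ^ (largest w k) 01-word SuffixOf w) × n ≤ largest w k
  largest-spec w zero .zero z≤n s = s , z≤n
  largest-spec w (suc k) n n≤k s with δ^ (suc k) 01-word SuffixOf? w
  ... | yes t = t , n≤k
  ... | no ¬t with m≤n⇒m<n∨m≡n n≤k
  ...   | inj₁ (s≤s n≤k′) = largest-spec w k n n≤k′ s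
  ...   | inj₂ refl       = ⊥-elim (¬t s)

  length-δ : ∀ u → length u ≤ length (δ u)
  length-δ []      = z≤n
  length-δ (𝟘 ∷ u) = s≤s (m≤n⇒m≤1+n (length-δ u))
  length-δ (𝟙 ∷ u) = s≤s (m≤n⇒m≤1+n (length-δ u))

  length-δ-< : ∀ u → 0 < length u → length u < length (δ u)
  length-δ-< (𝟘 ∷ u) _ = s≤s (s≤s (length-δ u))
  length-δ-< (𝟙 ∷ u) _ = s≤s (s≤s (length-δ u))

  length-δ^ : ∀ n → n < length (δ^ n 01-word)
  length-δ^ zero    = s≤s z≤n
  length-δ^ (suc n) = ≤-<-trans (length-δ^ n)
    (length-δ-< (δ^ n 01-word) (≤-<-trans z≤n (length-δ^ n)))

  level-bound : ∀ w n → δ^ n 01-word SuffixOf w → n ≤ length w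
  level-bound w n s = ≤-trans (<⇒≤ (length-δ^ n)) (length-mono s)

level-suffix : ∀ w n → δ^ n 01-word SuffixOf w → δ^ (level w) 01-word SuffixOf w
level-suffix w n s = proj₁ (largest-spec w (length w) n (level-bound w n s) s)

level-largest : ∀ w n → δ^ n 01-word SuffixOf w → n ≤ level w
level-largest w n s = proj₂ (largest-spec w (length w) n (level-bound w n s) s)

data B : Set where
  α β γ : B

extension : B → Word
extension α = 𝟘 ∷ 𝟘 ∷ []
extension β = 𝟘 ∷ 𝟙 ∷ 𝟘 ∷ 𝟘 ∷ []
extension γ = 𝟘 ∷ 𝟙 ∷ 𝟘 ∷ 𝟙 ∷ 𝟘 ∷ 𝟘 ∷ []

apply : B → Word → Word
apply b w = w ++ δ^ (level w) (extension b)

-- stage w f n is fₙ(⋯f₁(w)⋯), where fᵢ₊₁ is f i.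
stage : Word → (ℕ → B) → ℕ → Word
stage w f zero    = w
stage w f (suc n) = apply (f n) (stage w f n)

private
  δ^-nonempty : ∀ n u → 0 < length u → 0 < length (δ^ n u)
  δ^-nonempty zero    u p = p
  δ^-nonempty (suc n) u p =
    <-≤-trans (δ^-nonempty n u p) (length-δ (δ^ n u))

  extension-nonempty : ∀ b → 0 < length (extension b)
  extension-nonempty α = s≤s z≤n
  extension-nonempty β = s≤s z≤n
  extension-nonempty γ = s≤s z≤n

apply-longer : ∀ b w → length w < length (apply b w)
apply-longer b w = begin-strict
  length w                          ≡⟨ +-identityʳ _ ⟨
  length w + 0                      <⟨ +-monoʳ-< (length w)
                                         (δ^-nonempty (level w) (extension b)
                                            (extension-nonempty b)) ⟩
  length w + length (δ^ (level w) (extension b)) ≡⟨ length-++ w ⟨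
  length (apply b w)                ∎
  where open ≤-Reasoning

stage-length : ∀ w f n → n ≤ length (stage w f n)
stage-length w f zero    = z≤n
stage-length w f (suc n) =
  ≤-<-trans (stage-length w f n) (apply-longer (f n) (stage w f n))

infix 6 _•_

-- The k-th letter is read off the (k+1)-st stage, which is long enough; every
-- stage is a prefix of the result (see •-prefix).
_•_ : Word → (ℕ → B) → InfWord
(w • f) k = lookup (stage w f (suc k)) (fromℕ< (stage-length w f (suc k)))

private
  stage-++ : ∀ w f {m n} → m ≤ n → ∃[ s ] stage w f n ≡ stage w f m ++ s
  stage-++ w f {m} {zero} z≤n = [] , sym (++-identityʳ w)
  stage-++ w f {m} {suc n} m≤1+n with m≤n⇒m<n∨m≡n m≤1+n
  ... | inj₂ refl      = [] , sym (++-identityʳ _)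
  ... | inj₁ (s≤s m≤n) with s , eq ← stage-++ w f m≤n =
    s ++ e , trans (cong (_++ e) eq) (++-assoc (stage w f m) s e)
    where e = δ^ (level (stage w f n)) (extension (f n))

  lookup-++ : ∀ (xs ys zs : Word) → zs ≡ xs ++ ys → ∀ i
              (p : i < length xs) (q : i < length zs) →
              lookup zs (fromℕ< q) ≡ lookup xs (fromℕ< p)
  lookup-++ (x ∷ xs) ys _ refl zero    p q = refl
  lookup-++ (x ∷ xs) ys _ refl (suc i) (s≤s p) (s≤s q) = lookup-++ xs ys _ refl i p q

  applyUpTo-lookup : ∀ (g : ℕ → Letter) xs →
    (∀ i (p : i < length xs) → g i ≡ lookup xs (fromℕ< p)) →
    applyUpTo g (length xs) ≡ xs
  applyUpTo-lookup g []       h = refl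
  applyUpTo-lookup g (x ∷ xs) h =
    cong₂ _∷_ (h 0 (s≤s z≤n)) (applyUpTo-lookup (g ∘ suc) xs (λ i p → h (suc i) (s≤s p)))

•-prefix : ∀ w f n → applyUpTo (w • f) (length (stage w f n)) ≡ stage w f n
•-prefix w f n = applyUpTo-lookup (w • f) (stage w f n) agree
  where
  agree : ∀ i (p : i < length (stage w f n)) →
          (w • f) i ≡ lookup (stage w f n) (fromℕ< p)
  agree i p with ≤-total n (suc i)
  ... | inj₁ n≤ with s , eq ← stage-++ w f n≤ =
    lookup-++ (stage w f n) s _ eq i p (stage-length w f (suc i))
  ... | inj₂ ≤n with s , eq ← stage-++ w f ≤n =
    sym (lookup-++ (stage w f (suc i)) s _ eq i (stage-length w f (suc i)) p)

W : Pred (ℕ → B) 0ℓ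
W f = G (01-word • f)

_•[_] : Word → Pred (ℕ → B) 0ℓ → Pred InfWord 0ℓ
(w •[ F ]) x = ∃[ f ] F f × x ≗ w • f

{-# OPTIONS --safe #-}
module Submission where

-- In a good word two ones never have odd distance, since consecutive ones
-- have distance 2 or 4. Hence a good word is, up to its first letter, the
-- image δω u of a word u, and blocks of odd length in an image of a forbidden
-- pattern would force four consecutive zeros, or two ones of u at odd
-- distance. With blocks of even length the image of the pattern can be pulled
-- back along δ, so u is good if and only if δω u is. For the last three
-- equations it remains to see when a letter may be prepended to a good word.
-- For the first one, a word of G₀₁ is δω (0ᵉ x′) with e ≤ 2 and x′ in G₀₁;
-- iterating, it is δ(0^e₁) δ²(0^e₂) ⋯ δⁿ(0^eₙ) δⁿ(xₙ) with xₙ beginning with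
-- 01, and the n-th stage for f is the word δ(0^e₁) ⋯ δⁿ(0^eₙ) δⁿ(01) where
-- α, β, γ correspond to e = 0, 1, 2.

open import Defs
open import Data.Bool using (not)
open import Data.Bool.Properties using (not-involutive)
open import Data.Empty using (⊥; ⊥-elim)
open import Data.Fin.Patterns using (1F)
open import Data.List using ([]; _∷_; _++_; _∷ʳ_; length; concatMap; applyUpTo)
open import Data.List.Properties
  using (∷-injective; ∷-injectiveˡ; ∷-injectiveʳ; length-applyUpTo; length-++;
         ++-assoc; concatMap-++; ∷ʳ-injectiveʳ)
open import Data.List.Relation.Binary.Pointwise using (Pointwise-≡⇒≡; ≡⇒Pointwise-≡)
import Data.List.Relation.Binary.Suffix.Heterogeneous as Suffix
open import Data.List.Relation.Binary.Suffix.Heterogeneous.Properties using (length-mono)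
open import Data.Nat
open import Data.Nat.Properties
open import Data.Nat.Tactic.RingSolver using (solve-∀)
open import Data.Product using (_×_; _,_; ∃; ∃₂; ∃-syntax; proj₁; proj₂)
open import Data.Unit using (⊤; tt)
open import Data.Sum using (inj₁; inj₂)
import Data.Vec as Vec
open import Function using (_∘_)
open import Relation.Binary.PropositionalEquality
open import Relation.Nullary using (¬_; contradiction)
open import Relation.Unary using (_≐_; _∪_)

-- Suffixes and finite agreement of infinite words

tail : InfWord → InfWord
tail x = x ∘ suc

drop : ℕ → InfWord → InfWord
drop n x k = x (n + k)

□ : (InfWord → Set) → InfWord → Set
□ P x = ∀ i → P (drop i x)

0ω : InfWord
0ω _ = 𝟘

infix 4 _≈[_]_
_≈[_]_ : InfWord → ℕ → InfWord → Set
x ≈[ n ] y = ∀ {k} → k < n → x k ≡ y k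

≈-≤ : ∀ {x y m n} → m ≤ n → x ≈[ n ] y → x ≈[ m ] y
≈-≤ m≤n e k<m = e (<-≤-trans k<m m≤n)

≈-++ : ∀ {x y} m {n} → x ≈[ m ] y → drop m x ≈[ n ] drop m y → x ≈[ m + n ] y
≈-++ zero    e f          = f
≈-++ (suc m) e f {zero}   = λ _ → e z<s
≈-++ (suc m) e f {suc k} (s<s k<) = ≈-++ m (e ∘ s<s) f k<

-- Factors and occurrences of patterns

_BeginsWith_ : InfWord → Word → Set
x BeginsWith u = applyUpTo x (length u) ≡ u

applyUpTo-≈ : ∀ {x y} n → x ≈[ n ] y → applyUpTo x n ≡ applyUpTo y n
applyUpTo-≈ zero    e = refl
applyUpTo-≈ (suc n) e = cong₂ _∷_ (e z<s) (applyUpTo-≈ n (e ∘ s<s))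

applyUpTo-≈⁻¹ : ∀ {x y} n → applyUpTo x n ≡ applyUpTo y n → x ≈[ n ] y
applyUpTo-≈⁻¹ (suc n) e {zero}  _        = ∷-injectiveˡ e
applyUpTo-≈⁻¹ (suc n) e {suc k} (s<s k<) = applyUpTo-≈⁻¹ n (∷-injectiveʳ e) k<

++ω-beginsWith : ∀ u y → (u ++ω y) BeginsWith u
++ω-beginsWith []      y = refl
++ω-beginsWith (a ∷ u) y = cong (a ∷_) (++ω-beginsWith u y)

beginsWith⇒≗ : ∀ u {x} → x BeginsWith u → x ≗ u ++ω drop (length u) x
beginsWith⇒≗ []      e k       = refl
beginsWith⇒≗ (a ∷ u) e zero    = ∷-injectiveˡ e
beginsWith⇒≗ (a ∷ u) e (suc k) = beginsWith⇒≗ u (∷-injectiveʳ e) k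

≗⇒beginsWith : ∀ u {x y} → x ≗ u ++ω y → x BeginsWith u
≗⇒beginsWith u e = trans (applyUpTo-≈ (length u) (λ _ → e _)) (++ω-beginsWith u _)

beginsWith-++ : ∀ u {v x} → x BeginsWith u → drop (length u) x BeginsWith v →
                x BeginsWith (u ++ v)
beginsWith-++ []      e f = f
beginsWith-++ (a ∷ u) e f =
  cong₂ _∷_ (∷-injectiveˡ e) (beginsWith-++ u (∷-injectiveʳ e) f)

beginsWith-++⁻¹ : ∀ u {v x} → x BeginsWith (u ++ v) →
                  x BeginsWith u × drop (length u) x BeginsWith v
beginsWith-++⁻¹ []      e = refl , e
beginsWith-++⁻¹ (a ∷ u) e with d , f ← ∷-injective e
  with p , q ← beginsWith-++⁻¹ u f = cong₂ _∷_ d p , q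

factorOf-resp : ∀ {u x y} → x ≗ y → u FactorOf x → u FactorOf y
factorOf-resp {u} e (i , f) =
  i , trans (applyUpTo-≈ (length u) (λ _ → sym (e _))) f

good-resp : ∀ {x y} → x ≗ y → Good x → Good y
good-resp {x} {y} e (a , b , c , d) =
    a ∘ factorOf-resp (sym ∘ e)
  , b ∘ factorOf-resp (sym ∘ e)
  , (λ (g , ne , f) → c (g , ne , factorOf-resp (sym ∘ e) f))
  , (λ (g , ne , f) → d (g , ne , factorOf-resp (sym ∘ e) f))

good-tail : ∀ x → Good x → Good (tail x)
good-tail x (a , b , c , d) =
    (λ (i , e) → a (suc i , e))
  , (λ (i , e) → b (suc i , e))
  , (λ (g , ne , i , e) → c (g , ne , suc i , e))
  , (λ (g , ne , i , e) → d (g , ne , suc i , e))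

-- h a and ℓ a are the letters and the length of the image of a; only the
-- first ℓ a letters of h a matter.
Realises : (Letter → InfWord) → (Letter → ℕ) → Word → InfWord → Set
Realises h ℓ []      x = ⊤
Realises h ℓ (a ∷ p) x = x ≈[ ℓ a ] h a × Realises h ℓ p (drop (ℓ a) x)

Meets : Word → InfWord → Set
Meets p x = ∃₂ λ h ℓ → (∀ a → 0 < ℓ a) × Realises h ℓ p x

encounters⇒meets : ∀ p x → x Encounters p → ∃[ i ] Meets p (drop i x)
encounters⇒meets p x (g , ne , i , e) =
  -- The finite images are padded with zeros to infinite words; the lengths `length ∘ g` hide the
  -- padding.
  i , (λ a → g a ++ω 0ω) , length ∘ g , (λ a → positive (ne a)) , realises p e
  where
  positive : ∀ {u : Word} → u ≢ [] → 0 < length u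
  positive {[]}    ne = contradiction refl ne
  positive {_ ∷ _} ne = z<s

  realises : ∀ p {x} → x BeginsWith (concatMap g p) →
             Realises (λ a → g a ++ω 0ω) (length ∘ g) p x
  realises []      e = tt
  realises (a ∷ p) e with e₁ , e₂ ← beginsWith-++⁻¹ (g a) e =
      applyUpTo-≈⁻¹ (length (g a)) (trans e₁ (sym (++ω-beginsWith (g a) 0ω)))
    , realises p e₂

meets⇒encounters : ∀ p x i → Meets p (drop i x) → x Encounters p
meets⇒encounters p x i (h , ℓ , pos , r) = g , ne , i , begins p r
  where
  g : Letter → Word
  g a = applyUpTo (h a) (ℓ a)

  ne : NonErasing g
  ne a with suc _ ← ℓ a | z<s ← pos a = λ ()

  begins : ∀ p {x} → Realises h ℓ p x → x BeginsWith (concatMap g p)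
  begins []          r        = refl
  begins (a ∷ p) {x} (e , r) = beginsWith-++ (g a)
    (trans (cong (applyUpTo x) len) (applyUpTo-≈ (ℓ a) e))
    (subst (λ n → drop n x BeginsWith _) (sym len) (begins p r))
    where len = length-applyUpTo (h a) (ℓ a)

data Forbidden : Set where
  fourth-power XXXYXYXX : Forbidden

pattern-of : Forbidden → Word
pattern-of fourth-power = 𝟘 ∷ 𝟘 ∷ 𝟘 ∷ 𝟘 ∷ []
pattern-of XXXYXYXX     = 𝟘 ∷ 𝟘 ∷ 𝟘 ∷ 𝟙 ∷ 𝟘 ∷ 𝟙 ∷ 𝟘 ∷ 𝟘 ∷ []

-- A reformulation of goodness

twice : ℕ → ℕ
twice zero    = zero
twice (suc n) = suc (suc (twice n))

OddZeros : InfWord → Set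
OddZeros x = ∀ m → x (suc (twice m)) ≡ 𝟘

NoOddGap : InfWord → Set
NoOddGap x = x 0 ≡ 𝟙 → OddZeros x

Avoids : InfWord → Set
Avoids x = ∀ q → ¬ Meets (pattern-of q) x

good⇒no11 : ∀ x → Good x → x 0 ≡ 𝟙 → x 1 ≡ 𝟘
good⇒no11 x (no11 , _) e₀ with x 1 in e₁
... | 𝟘 = refl
... | 𝟙 = contradiction (0 , cong₂ _∷_ e₀ (cong₂ _∷_ e₁ refl)) no11

good⇒no1001 : ∀ x → Good x → x 0 ≡ 𝟙 → x 1 ≡ 𝟘 → x 2 ≡ 𝟘 → x 3 ≡ 𝟘
good⇒no1001 x (_ , no1001 , _) e₀ e₁ e₂ with x 3 in e₃
... | 𝟘 = refl
... | 𝟙 = contradiction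
  (0 , cong₂ _∷_ e₀ (cong₂ _∷_ e₁ (cong₂ _∷_ e₂ (cong₂ _∷_ e₃ refl)))) no1001

good⇒no0000 : ∀ x → Good x → x 0 ≡ 𝟘 → x 1 ≡ 𝟘 → x 2 ≡ 𝟘 → x 3 ≡ 𝟙
good⇒no0000 x (_ , _ , no⁴ , _) e₀ e₁ e₂ with x 3 in e₃
... | 𝟙 = refl
... | 𝟘 = contradiction ((λ _ → 𝟘 ∷ []) , (λ _ ()) , 0 ,
  cong₂ _∷_ e₀ (cong₂ _∷_ e₁ (cong₂ _∷_ e₂ (cong₂ _∷_ e₃ refl)))) no⁴

-- Induction along the ones: after a one, the exclusion of 11, 1001 and 0000 forces the next one to
-- come after 2 or 4 letters, and the letters at odd distance up to there are zero.
good⇒noOddGap : ∀ x → Good x → NoOddGap x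
good⇒noOddGap x good e₀ zero = good⇒no11 x good e₀
good⇒noOddGap x good e₀ (suc m) with x 2 in e₂
... | 𝟙 = good⇒noOddGap (drop 2 x) (good-tail (tail x) (good-tail x good)) e₂ m
... | 𝟘 with e₁ ← good⇒no11 x good e₀
        with e₃ ← good⇒no1001 x good e₀ e₁ e₂
        with m
...   | zero   = e₃
...   | suc m′ = good⇒noOddGap (drop 4 x)
  (good-tail (drop 3 x) (good-tail (drop 2 x) (good-tail (tail x) (good-tail x good))))
  (good⇒no0000 (tail x) (good-tail x good) e₁ e₂ e₃) m′

good⇒□noOddGap : ∀ x → Good x → □ NoOddGap x
good⇒□noOddGap x good zero    = good⇒noOddGap x good
good⇒□noOddGap x good (suc i) = good⇒□noOddGap (tail x) (good-tail x good) i

good⇒□avoids : ∀ x → Good x → □ Avoids x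
good⇒□avoids x (_ , _ , c , _) i fourth-power = c ∘ meets⇒encounters _ x i
good⇒□avoids x (_ , _ , _ , d) i XXXYXYXX     = d ∘ meets⇒encounters _ x i

no11∧no1001∧□avoids⇒good : ∀ x →
  (□ λ y → y 0 ≡ 𝟙 → y 1 ≡ 𝟘) x →
  (□ λ y → y 0 ≡ 𝟙 → y 1 ≡ 𝟘 → y 2 ≡ 𝟘 → y 3 ≡ 𝟘) x →
  □ Avoids x → Good x
no11∧no1001∧□avoids⇒good x no11 no1001 avoids =
    no11′ , no1001′
  , (λ enc → let i , m = encounters⇒meets _ x enc in avoids i fourth-power m)
  , (λ enc → let i , m = encounters⇒meets _ x enc in avoids i XXXYXYXX m)
  where
  no11′ : ¬ ((𝟙 ∷ 𝟙 ∷ []) FactorOf x)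
  no11′ (i , e) with e₀ , e′ ← ∷-injective e with e₁ , _ ← ∷-injective e′ =
    contradiction (trans (sym (no11 i e₀)) e₁) λ ()

  no1001′ : ¬ ((𝟙 ∷ 𝟘 ∷ 𝟘 ∷ 𝟙 ∷ []) FactorOf x)
  no1001′ (i , e) with e₀ , e′ ← ∷-injective e with e₁ , e″ ← ∷-injective e′
    with e₂ , e‴ ← ∷-injective e″ with e₃ , _ ← ∷-injective e‴ =
    contradiction (trans (sym (no1001 i e₀ e₁ e₂)) e₃) λ ()

□noOddGap∧□avoids⇒good : ∀ x → □ NoOddGap x → □ Avoids x → Good x
□noOddGap∧□avoids⇒good x gaps =
  -- The odd distances 1 and 3 exclude 11 and 1001 respectively.
  no11∧no1001∧□avoids⇒good x (λ i e₀ → gaps i e₀ 0) (λ i e₀ _ _ → gaps i e₀ 1)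

-- The morphism δ on infinite words

δω-even : ∀ u m → δω u (twice m) ≡ 𝟘
δω-even u (suc m) = δω-even (tail u) m
δω-even u zero with u 0
... | 𝟘 = refl
... | 𝟙 = refl

δω-odd : ∀ u m → δω u (suc (twice m)) ≡ not (u m)
δω-odd u (suc m) = δω-odd (tail u) m
δω-odd u zero with u 0
... | 𝟘 = refl
... | 𝟙 = refl

decode : InfWord → InfWord
decode x k = not (x (suc (twice k)))

decode-δω : ∀ u → u ≗ decode (δω u)
decode-δω u k = sym (trans (cong not (δω-odd u k)) (not-involutive (u k)))

δω-decode : ∀ {x} → (∀ m → x (twice m) ≡ 𝟘) → x ≗ δω (decode x)
δω-decode {x} e zero          = trans (e 0) (sym (δω-even (decode x) 0))
δω-decode {x} e (suc zero)    =
  sym (trans (δω-odd (decode x) 0) (not-involutive (x 1)))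
δω-decode     e (suc (suc n)) = δω-decode (e ∘ suc) n

-- The additional letter is 𝟘, because every image of a letter begins with 𝟘.
δω-≈ : ∀ {x y n} → x ≈[ n ] y → δω x ≈[ suc (twice n) ] δω y
δω-≈ {x} {y} e {zero} _ = trans (δω-even x 0) (sym (δω-even y 0))
δω-≈ {n = zero}  e {suc zero} (s<s ())
δω-≈ {n = suc n} e {suc zero} _ = cong (λ a → Vec.lookup (δ-letter a) 1F) (e z<s)
δω-≈ {n = zero}  e {suc (suc k)} (s<s ())
δω-≈ {n = suc n} e {suc (suc k)} (s<s (s<s k<)) = δω-≈ {n = n} (e ∘ s<s) k<

δω-cong : ∀ {x y} → x ≗ y → δω x ≗ δω y
δω-cong e n = δω-≈ {n = n} (λ _ → e _) (s<s (n≤twice n))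
  where
  n≤twice : ∀ n → n ≤ twice n
  n≤twice zero    = z≤n
  n≤twice (suc n) = s≤s (m≤n⇒m≤1+n (n≤twice n))

□-δω : ∀ P {u} → (∀ i → P (δω (drop i u))) → (∀ i → P (tail (δω (drop i u)))) →
       □ P (δω u)
□-δω P h t zero          = h 0
□-δω P h t (suc zero)    = t 0
□-δω P h t (suc (suc i)) = □-δω P (h ∘ suc) (t ∘ suc) i

□-δω⁻¹ : ∀ P {u} → □ P (δω u) → ∀ i → P (δω (drop i u))
□-δω⁻¹ P h zero    = h 0
□-δω⁻¹ P h (suc i) = □-δω⁻¹ P (h ∘ suc ∘ suc) i

δω-□noOddGap : ∀ u → □ NoOddGap (δω u)
δω-□noOddGap u = □-δω NoOddGap
  (λ i e → contradiction (trans (sym (δω-even (drop i u) 0)) e) λ ())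
  (λ i _ m → δω-even (drop i u) (suc m))

-- Properties shared by δω and tail ∘ δω; ι k is the position that encodes
-- the k-th letter of the argument.
record Doubling (σ : InfWord → InfWord) : Set where
  field
    drop-twice : ∀ m u → drop (twice m) (σ u) ≡ σ (drop m u)
    ≈-twice    : ∀ {x y n} → x ≈[ n ] y → σ x ≈[ twice n ] σ y
    ι          : ℕ → ℕ
    ι-<        : ∀ {k n} → k < n → ι k < twice n
    ι-decodes  : ∀ u k → u k ≡ not (σ u (ι k))

  meets-double : ∀ p {u} → Meets p u → Meets p (σ u)
  meets-double p (h , ℓ , pos , r) =
    σ ∘ h , twice ∘ ℓ , (λ a → m<n⇒0<n (ι-< (pos a))) , double p r
    where
    double : ∀ p {u} → Realises h ℓ p u → Realises (σ ∘ h) (twice ∘ ℓ) p (σ u)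
    double []          r       = tt
    double (a ∷ p) {u} (e , r) =
      ≈-twice e , subst (Realises _ _ p) (sym (drop-twice (ℓ a) u)) (double p r)

  -- Blocks of even length all start at the same parity, so each block of `σ u` encodes a block of
  -- `u` of half the length, read off at the positions `ι k`.
  realises-halve : ∀ p {h ℓ u} → Realises h (twice ∘ ℓ) p (σ u) →
                   Realises (λ a k → not (h a (ι k))) ℓ p u
  realises-halve []              r       = tt
  realises-halve (a ∷ p) {ℓ = ℓ} {u} (e , r) =
      (λ {k} k< → trans (ι-decodes u k) (cong not (e (ι-< k<))))
    , realises-halve p (subst (Realises _ _ p) (drop-twice (ℓ a) u) r)

δω-doubling : Doubling δω
δω-doubling = record
  { drop-twice = drop-twice
  ; ≈-twice    = λ {_} {_} {n} e k< → δω-≈ {n = n} e (m<n⇒m<1+n k<)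
  ; ι          = suc ∘ twice
  ; ι-<        = ι-<
  ; ι-decodes  = decode-δω
  }
  where
  drop-twice : ∀ m u → drop (twice m) (δω u) ≡ δω (drop m u)
  drop-twice zero    u = refl
  drop-twice (suc m) u = drop-twice m (tail u)

  ι-< : ∀ {k n} → k < n → suc (twice k) < twice n
  ι-< {zero}  (s<s _)  = s<s z<s
  ι-< {suc k} (s<s k<) = s<s (s<s (ι-< k<))

tail∘δω-doubling : Doubling (tail ∘ δω)
tail∘δω-doubling = record
  { drop-twice = drop-twice
  ; ≈-twice    = λ {_} {_} {n} e k< → δω-≈ {n = n} e (s<s k<)
  ; ι          = twice
  ; ι-<        = λ k< → <-trans (n<1+n _) (Doubling.ι-< δω-doubling k<)
  ; ι-decodes  = decode-δω
  }
  where
  drop-twice : ∀ m u → drop (twice m) (tail (δω u)) ≡ tail (δω (drop m u))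
  drop-twice zero    u = refl
  drop-twice (suc m) u = drop-twice m (tail u)

-- Lengths of the blocks in δω u and tail (δω u)

twice≡ : ∀ n → twice n ≡ n + n
twice≡ zero    = refl
twice≡ (suc n) = cong suc (trans (cong suc (twice≡ n)) (sym (+-suc n n)))

data Halving : ℕ → Set where
  even : ∀ m → Halving (twice m)
  odd  : ∀ m → Halving (suc (twice m))

halving : ∀ n → Halving n
halving zero = even zero
halving (suc n) with halving n
... | even m = odd m
... | odd m  = even (suc m)

-- A one in the first copy would recur in the second copy at the odd distance 2m + 1.
repeat-odd⇒zero : ∀ {x z n} m → □ NoOddGap x → x ≈[ n ] z →
                  drop (suc (twice m)) x ≈[ n ] z → x ≈[ n ] 0ω
repeat-odd⇒zero {x} m gaps e f {k} k< with x k in eq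
... | 𝟘 = refl
... | 𝟙 = trans (sym eq) (trans (e k<) (trans (sym (f k<))
  (trans (cong x (+-comm (suc (twice m)) k))
         (gaps k (trans (cong x (+-identityʳ k)) eq) m))))

zero-copy : ∀ {x y z n} → x ≈[ n ] z → x ≈[ n ] 0ω → y ≈[ n ] z → y ≈[ n ] 0ω
zero-copy e e₀ f k< = trans (f k<) (trans (sym (e k<)) (e₀ k<))

lengths : ℕ → ℕ → Letter → ℕ
lengths a b 𝟘 = a
lengths a b 𝟙 = b

-- Copies of a block of odd length lie at odd distance, so the block consists of zeros and its four
-- copies begin with 0000.
fourth-power-even : ∀ {x} h a b → □ NoOddGap x → ¬ x ≈[ 4 ] 0ω →
  Realises h (lengths a b) (pattern-of fourth-power) x → ∃[ m ] a ≡ twice m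
fourth-power-even h a b gaps no⁴ (e₁ , e₂ , e₃ , e₄ , _) with halving a
... | even m = m , refl
... | odd m  = ⊥-elim (no⁴
  (≈-≤ (+-mono-≤ 1≤ (+-mono-≤ 1≤ (+-mono-≤ 1≤ 1≤)))
       (≈-++ a z (≈-++ a (copy e₂) (≈-++ a (copy e₃) (copy e₄))))))
  where
  1≤ : 1 ≤ suc (twice m)
  1≤ = s≤s z≤n
  z    = repeat-odd⇒zero m gaps e₁ e₂
  copy : ∀ {y} → y ≈[ a ] _ → y ≈[ a ] 0ω
  copy = zero-copy e₁ z

-- The shape that remains when X = 0 and Y has odd length 2c + 1: the image starts with 000, and its
-- last X stands at position 7 + 4c.
Exceptional : InfWord → Set
Exceptional x = x ≈[ 3 ] 0ω × ∃[ c ] x (suc (twice (suc (twice (suc c))))) ≡ 𝟘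

-- If a length is odd, two copies of X or two copies of Y lie at odd distance, so that block is
-- zero. This gives 0000 at the beginning, unless X is a single zero and Y has odd length.
XXXYXYXX-even : ∀ {x} h a b → 0 < a → 0 < b → □ NoOddGap x → ¬ x ≈[ 4 ] 0ω →
  ¬ Exceptional x → Realises h (lengths a b) (pattern-of XXXYXYXX) x →
  (∃[ m ] a ≡ twice m) × (∃[ n ] b ≡ twice n)
XXXYXYXX-even {x} h a b 0<a 0<b gaps no⁴ ¬exc (e₁ , e₂ , e₃ , e₄ , e₅ , e₆ , e₇ , e₈ , _)
  with halving a | halving b
... | even m | even n = (m , refl) , (n , refl)
... | even (suc m) | odd n = ⊥-elim (no⁴
  (≈-≤ (+-mono-≤ 2≤ 2≤) (≈-++ a z (zero-copy e₁ z e₂))))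
  where
  2≤ : 2 ≤ twice (suc m)
  2≤ = s≤s (s≤s z≤n)

  rearrange : ∀ m n k → suc (twice (m + m + m + n)) + k ≡
              twice m + (twice m + (twice m + (suc (twice n) + k)))
  rearrange m n k rewrite twice≡ m | twice≡ n | twice≡ (m + m + m + n) = lemma m n k
    where
    lemma : ∀ m n k → suc ((m + m + m + n) + (m + m + m + n)) + k ≡
            (m + m) + ((m + m) + ((m + m) + (suc (n + n) + k)))
    lemma = solve-∀

  -- The first and the fourth X have distance 3a + b, which is odd.
  z = repeat-odd⇒zero (suc m + suc m + suc m + n) gaps e₁
        (λ {k} k< → trans (cong x (rearrange (suc m) n k)) (e₅ k<))
... | odd (suc m) | _ = ⊥-elim (no⁴
  (≈-≤ (+-mono-≤ 2≤ 2≤) (≈-++ a z (zero-copy e₁ z e₂))))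
  where
  2≤ : 2 ≤ suc (twice (suc m))
  2≤ = s≤s (s≤s z≤n)
  z  = repeat-odd⇒zero (suc m) gaps e₁ e₂
... | odd zero | even (suc n) = ⊥-elim (no⁴ (≈-++ 3 zzz (≈-≤ (s≤s z≤n) zY)))
  where
  z = repeat-odd⇒zero 0 gaps e₁ e₂

  zzz : x ≈[ 3 ] 0ω
  zzz = ≈-++ 1 z (≈-++ 1 (zero-copy e₁ z e₂) (zero-copy e₁ z e₃))

  -- With X of length 1 the two copies of Y have distance b + 1, which is odd; so Y continues 000 to
  -- 0000.
  zY : drop 3 x ≈[ twice (suc n) ] 0ω
  zY = repeat-odd⇒zero (suc n) (gaps ∘ (3 +_)) e₄
         (λ {k} k< → trans (cong (drop 3 x) (sym (+-suc (twice (suc n)) k))) (e₆ k<))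
... | odd zero | odd n = ⊥-elim (¬exc (zzz , n , last))
  where
  z = repeat-odd⇒zero 0 gaps e₁ e₂

  zzz : x ≈[ 3 ] 0ω
  zzz = ≈-++ 1 z (≈-++ 1 (zero-copy e₁ z e₂) (zero-copy e₁ z e₃))

  position : ∀ t → suc (suc (suc (suc (suc (suc (suc (t + t))))))) ≡
             3 + (suc t + (1 + (suc t + (1 + 0))))
  position = solve-∀

  last : x (suc (twice (suc (twice (suc n))))) ≡ 𝟘
  last = trans (cong x (trans (cong (7 +_) (twice≡ (twice n))) (position (twice n))))
               (zero-copy e₁ z e₈ z<s)

meets-halve : ∀ {σ u} → Doubling σ →
  □ NoOddGap (σ u) → ¬ σ u ≈[ 4 ] 0ω → ¬ Exceptional (σ u) →
  ∀ q → Meets (pattern-of q) (σ u) → Meets (pattern-of q) u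
meets-halve {σ} {u} D gaps no⁴ ¬exc q (h , ℓ , pos , r) = go q r
  where
  halve : ∀ p {a b} → 0 < a → 0 < b → ∃[ m ] a ≡ twice m → ∃[ n ] b ≡ twice n →
          Realises h (lengths a b) p (σ u) → Meets p u
  halve p 0<a 0<b (suc m , refl) (suc n , refl) r =
    _ , lengths (suc m) (suc n) , (λ { 𝟘 → z<s ; 𝟙 → z<s }) ,
    Doubling.realises-halve D p (subst-lengths p r)
    where
    subst-lengths : ∀ p {x} → Realises h (lengths (twice (suc m)) (twice (suc n))) p x →
                    Realises h (twice ∘ lengths (suc m) (suc n)) p x
    subst-lengths []      r       = tt
    subst-lengths (𝟘 ∷ p) (e , r) = e , subst-lengths p r
    subst-lengths (𝟙 ∷ p) (e , r) = e , subst-lengths p r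

  go : ∀ q → Realises h ℓ (pattern-of q) (σ u) → Meets (pattern-of q) u
  go fourth-power r =
    -- The letter `𝟙` does not occur in this pattern, so its length can be set to `ℓ 𝟘`.
    let a-even = fourth-power-even h (ℓ 𝟘) (ℓ 𝟘) gaps no⁴ r
    in halve _ (pos 𝟘) (pos 𝟘) a-even a-even r
  go XXXYXYXX r =
    let a-even , b-even = XXXYXYXX-even h (ℓ 𝟘) (ℓ 𝟙) (pos 𝟘) (pos 𝟙) gaps no⁴ ¬exc r
    in halve _ (pos 𝟘) (pos 𝟙) a-even b-even r

-- Goodness of `u` and of `δω u`

zero⇒one : ∀ u k → δω u (suc (twice k)) ≡ 𝟘 → u k ≡ 𝟙
zero⇒one u k e = trans (decode-δω u k) (cong not e)

-- A zero at an odd position of `δω u` encodes a one of `u`. So 0000 at the beginning gives ones of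
-- `u` at distance 1, and the exceptional shape gives ones at the odd distance 2c + 3.
avoids-δω : ∀ {u} → NoOddGap u → Avoids u → Avoids (δω u)
avoids-δω {u} gap avoids q = avoids q ∘
  meets-halve {u = u} δω-doubling (δω-□noOddGap u)
    (λ z → contradiction (trans (sym (zero⇒one u 1 (z (s<s (s<s (s<s z<s))))))
                                (gap (zero⇒one u 0 (z (s<s z<s))) 0)) λ ())
    (λ (z , c , e) → contradiction
      (trans (sym (zero⇒one u _ e)) (gap (zero⇒one u 0 (z (s<s z<s))) (suc c))) λ ())
    q

-- Here already 000 at the beginning encodes 11 in `u`, which rules out 0000 and the exceptional
-- shape at once.
avoids-tail-δω : ∀ {u} → (u 0 ≡ 𝟙 → u 1 ≡ 𝟘) → Avoids u → Avoids (tail (δω u))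
avoids-tail-δω {u} no11 avoids q = avoids q ∘
  meets-halve {u = u} tail∘δω-doubling (δω-□noOddGap u ∘ suc)
    (λ z → no³ (≈-≤ {x = tail (δω u)} {0ω} (n≤1+n 3) z)) (no³ ∘ proj₁) q
  where
  no³ : ¬ tail (δω u) ≈[ 3 ] 0ω
  no³ z = contradiction
    (trans (sym (zero⇒one u 1 (z (s<s (s<s z<s))))) (no11 (zero⇒one u 0 (z z<s)))) λ ()

good-drop : ∀ x → Good x → □ Good x
good-drop x good zero    = good
good-drop x good (suc i) = good-drop (tail x) (good-tail x good) i

-- The ones of `δω u` all stand at odd positions, hence at even distances. Its suffixes are images
-- of suffixes of `u` or tails of such images, which the two preceding lemmas cover.
good-δω : ∀ {u} → Good u → Good (δω u)
good-δω {u} good = □noOddGap∧□avoids⇒good (δω u) (δω-□noOddGap u)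
  (□-δω Avoids
    (λ i → avoids-δω (gaps i) (avoids i))
    (λ i → avoids-tail-δω (λ e → gaps i e 0) (avoids i)))
  where
  gaps   = good⇒□noOddGap u good
  avoids = good⇒□avoids u good

avoids-tail-δω⁻¹ : ∀ {u} → Avoids (tail (δω u)) → Avoids u
avoids-tail-δω⁻¹ avoids q = avoids q ∘ Doubling.meets-double tail∘δω-doubling (pattern-of q)

avoids-δω⁻¹ : ∀ {u} → Avoids (δω u) → Avoids u
avoids-δω⁻¹ avoids q = avoids q ∘ Doubling.meets-double δω-doubling (pattern-of q)

δω-++ω : ∀ u y → δω (u ++ω y) ≗ δ u ++ω δω y
δω-++ω []      y n             = refl
δω-++ω (𝟘 ∷ u) y zero          = refl
δω-++ω (𝟘 ∷ u) y (suc zero)    = refl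
δω-++ω (𝟘 ∷ u) y (suc (suc n)) = δω-++ω u y n
δω-++ω (𝟙 ∷ u) y zero          = refl
δω-++ω (𝟙 ∷ u) y (suc zero)    = refl
δω-++ω (𝟙 ∷ u) y (suc (suc n)) = δω-++ω u y n

δω-beginsWith : ∀ u {x} → x BeginsWith u → δω x BeginsWith δ u
δω-beginsWith u {x} e = ≗⇒beginsWith (δ u)
  (λ n → trans (δω-cong (beginsWith⇒≗ u e) n) (δω-++ω u (drop (length u) x) n))

-- A factor 11 of `u` would become 0000, a factor 1001 would become δ(1001) = 00010100, and an image
-- of a forbidden pattern would become one with doubled blocks.
good-δω⁻¹ : ∀ {u} → Good (δω u) → Good u
good-δω⁻¹ {u} good = no11∧no1001∧□avoids⇒good u
  (λ i → no11 (drop i u) (goods i)) (λ i → no1001 (drop i u) (goods i))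
  (λ i → avoids-δω⁻¹ (good⇒□avoids (δω (drop i u)) (goods i) 0))
  where
  goods : ∀ i → Good (δω (drop i u))
  goods = □-δω⁻¹ Good {u} (good-drop (δω u) good)

  no11 : ∀ v → Good (δω v) → v 0 ≡ 𝟙 → v 1 ≡ 𝟘
  no11 v good e₀ = trans (decode-δω v 1) (cong not
    (good⇒no0000 (δω v) good (δω-even v 0) (trans (δω-odd v 0) (cong not e₀)) (δω-even v 1)))

  no1001 : ∀ v → Good (δω v) → v 0 ≡ 𝟙 → v 1 ≡ 𝟘 → v 2 ≡ 𝟘 → v 3 ≡ 𝟘
  no1001 v (_ , _ , _ , no) e₀ e₁ e₂ with v 3 in e₃
  ... | 𝟘 = refl
  -- The word δ(1001) is the second pattern itself, encountered through the identity morphism.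
  ... | 𝟙 = contradiction ((_∷ []) , (λ _ ()) , 0 ,
    δω-beginsWith (𝟙 ∷ 𝟘 ∷ 𝟘 ∷ 𝟙 ∷ []) {v}
      (cong₂ _∷_ e₀ (cong₂ _∷_ e₁ (cong₂ _∷_ e₂ (cong₂ _∷_ e₃ refl))))) no

-- Prepending letters to good words

G[]⁺ : ∀ w {x} → Good x → x BeginsWith w → G[ w ] x
G[]⁺ w {x} good e = good , drop (length w) x , tt , beginsWith⇒≗ w e

G[]⇒beginsWith : ∀ w {x} → G[ w ] x → x BeginsWith w
G[]⇒beginsWith w (_ , _ , _ , e) = ≗⇒beginsWith w e

good-cons : ∀ x → (x 0 ≡ 𝟙 → x 1 ≡ 𝟘) → (x 0 ≡ 𝟙 → x 1 ≡ 𝟘 → x 2 ≡ 𝟘 → x 3 ≡ 𝟘) →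
            Avoids x → Good (tail x) → Good x
good-cons x no11 no1001 avoids good = no11∧no1001∧□avoids⇒good x
  (λ { zero → no11   ; (suc i) → good⇒no11 (drop i (tail x)) (goods i) })
  (λ { zero → no1001 ; (suc i) → good⇒no1001 (drop i (tail x)) (goods i) })
  (λ { zero → avoids ; (suc i) → good⇒□avoids (tail x) good i })
  where goods = good-drop (tail x) good

good⇒δω : ∀ x → Good (tail x) → x 0 ≡ 𝟘 → x 1 ≡ 𝟙 → x ≗ δω (decode x)
good⇒δω x good e₀ e₁ = δω-decode
  λ { zero → e₀ ; (suc m) → good⇒noOddGap (tail x) good e₁ m }

-- In δω u every even letter is 𝟘. So an image of a forbidden pattern at the
-- beginning of δω u with even lengths is followed by its own first letter 𝟘,
-- and deleting this first letter yields a conjugate image in tail (δω u).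
good-𝟘∷ : ∀ y → Good y → y 0 ≡ 𝟙 → Good ((𝟘 ∷ []) ++ω y)
good-𝟘∷ y good e₀ = good-resp (sym ∘ x≗δωu) (good-δω good-u)
  where
  x = (𝟘 ∷ []) ++ω y
  u = decode x

  x≗δωu : x ≗ δω u
  x≗δωu = good⇒δω x good refl e₀

  u₀ : u 0 ≢ 𝟙
  u₀ e = contradiction (trans (sym e) (cong not e₀)) λ ()

  good-u : Good u
  good-u = good-cons u (λ e → ⊥-elim (u₀ e)) (λ e → ⊥-elim (u₀ e))
    (avoids-tail-δω⁻¹ (good⇒□avoids (tail (δω u)) (good-resp (x≗δωu ∘ suc) good) 0))
    (good-δω⁻¹ (good-resp (x≗δωu ∘ suc ∘ suc) (good-tail y good)))

-- Since δ(1) = 00, the word 0 `δω u` is the tail of the image of 1`u`, so it would inherit any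
-- forbidden image at the beginning of 1`u`.
good-𝟙∷ : ∀ u → Good ((𝟘 ∷ []) ++ω δω u) → u 0 ≡ 𝟘 → (u 1 ≡ 𝟘 → u 2 ≡ 𝟘) →
          Good ((𝟙 ∷ []) ++ω u)
good-𝟙∷ u good e₀ e₁₂ = good-cons ((𝟙 ∷ []) ++ω u) (λ _ → e₀) (λ _ _ e₁ → e₁₂ e₁)
  (avoids-tail-δω⁻¹ (good⇒□avoids (tail (δω ((𝟙 ∷ []) ++ω u)))
    (good-resp (λ n → sym (δω-++ω (𝟙 ∷ []) u (suc n))) good) 0))
  (good-δω⁻¹ (good-tail ((𝟘 ∷ []) ++ω δω u) good))

-- If 1001⋯ begins with an image of 000, the length of the image of 0 is at
-- least 3, so that 1001 recurs in u.
001⇒avoids-𝟙∷ : ∀ u → Good u → u BeginsWith (𝟘 ∷ 𝟘 ∷ 𝟙 ∷ []) → Avoids ((𝟙 ∷ []) ++ω u)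
001⇒avoids-𝟙∷ u (_ , no1001 , _) e q (h , ℓ , pos , r) = go (ℓ 𝟘) (pos 𝟘) (period q r)
  where
  v  = (𝟙 ∷ []) ++ω u
  e₀ = ∷-injectiveˡ e
  e₁ = ∷-injectiveˡ (∷-injectiveʳ e)
  e₂ = ∷-injectiveˡ (∷-injectiveʳ (∷-injectiveʳ e))

  period₃ : ∀ {a z} → v ≈[ a ] z → drop a v ≈[ a ] z → drop a (drop a v) ≈[ a ] z →
            drop a v ≈[ a + a ] v
  period₃ {a} X₁ X₂ X₃ = ≈-++ a (λ k< → trans (X₂ k<) (sym (X₁ k<)))
                                (λ k< → trans (X₃ k<) (sym (X₂ k<)))

  period : ∀ q → Realises h ℓ (pattern-of q) v → drop (ℓ 𝟘) v ≈[ ℓ 𝟘 + ℓ 𝟘 ] v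
  period fourth-power (X₁ , X₂ , X₃ , _) = period₃ X₁ X₂ X₃
  period XXXYXYXX     (X₁ , X₂ , X₃ , _) = period₃ X₁ X₂ X₃

  go : ∀ a → 0 < a → drop a v ≈[ a + a ] v → ⊥
  go 1 _ p = contradiction (trans (sym (p z<s)) e₀) λ ()
  go 2 _ p = contradiction (trans (sym (p z<s)) e₁) λ ()
  go (suc (suc (suc a))) _ p = no1001 (suc (suc a) ,
    cong₂ _∷_ (p z<s) (cong₂ _∷_ (trans (p (s<s z<s)) e₀)
      (cong₂ _∷_ (trans (p (s<s (s<s z<s))) e₁)
        (cong₂ _∷_ (trans (p 3<) e₂) refl))))
    where
    3< : 3 < 3 + a + (3 + a)
    3< = s<s (s<s (s<s (≤-trans z<s (m≤n+m (3 + a) a))))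

-- The word is the tail of `δω v` for `v` = 1`u`. This `v` begins with 1001 and is not good, but
-- avoiding the patterns at its beginning suffices, as the ones of any image have even distances.
001⇒good-𝟘∷δω : ∀ u → Good u → u BeginsWith (𝟘 ∷ 𝟘 ∷ 𝟙 ∷ []) → Good ((𝟘 ∷ []) ++ω δω u)
001⇒good-𝟘∷δω u good e = good-resp (λ n → δω-++ω (𝟙 ∷ []) u (suc n))
  (□noOddGap∧□avoids⇒good (tail (δω v)) (δω-□noOddGap v ∘ suc)
    λ { zero    → avoids-tail-δω (λ _ → ∷-injectiveˡ e) (001⇒avoids-𝟙∷ u good e)
      ; (suc i) → good⇒□avoids (δω u) (good-δω good) i })
  where v = (𝟙 ∷ []) ++ω u

-- The equations for G₀₀₁, G₀₀₀₁ and G₁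

G001-equation : G[ 𝟘 ∷ 𝟘 ∷ 𝟙 ∷ [] ]
  ≐ ((𝟘 ∷ []) · δ[ ((𝟘 ∷ 𝟙 ∷ []) ⁻¹· G[ 𝟘 ∷ 𝟙 ∷ [] ]) ∪ G[ 𝟘 ∷ 𝟘 ∷ 𝟙 ∷ [] ] ])
G001-equation = to , from
  where
  to : ∀ {w} → G[ 𝟘 ∷ 𝟘 ∷ 𝟙 ∷ [] ] w → _
  to {w} g@(good , _) = δω u , (u , split (u 1) (u 2) refl refl , λ _ → refl) , w≗0δωu
    where
    e  = G[]⇒beginsWith (𝟘 ∷ 𝟘 ∷ 𝟙 ∷ []) g
    w₀ = ∷-injectiveˡ e
    w₁ = ∷-injectiveˡ (∷-injectiveʳ e)
    w₂ = ∷-injectiveˡ (∷-injectiveʳ (∷-injectiveʳ e))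
    u  = decode (tail w)

    tail-w≗δωu : tail w ≗ δω u
    tail-w≗δωu = good⇒δω (tail w) (good-tail (tail w) (good-tail w good)) w₁ w₂

    w≗0δωu : w ≗ (𝟘 ∷ []) ++ω δω u
    w≗0δωu zero    = w₀
    w≗0δωu (suc n) = tail-w≗δωu n

    good-u : Good u
    good-u = good-δω⁻¹ (good-resp tail-w≗δωu (good-tail w good))

    u₀ : u 0 ≡ 𝟘
    u₀ = cong not w₂

    01u : (u 1 ≡ 𝟘 → u 2 ≡ 𝟘) → G[ 𝟘 ∷ 𝟙 ∷ [] ] ((𝟘 ∷ 𝟙 ∷ []) ++ω u)
    01u h = G[]⁺ (𝟘 ∷ 𝟙 ∷ [])
      (good-resp {(𝟘 ∷ []) ++ω (𝟙 ∷ []) ++ω u} {(𝟘 ∷ 𝟙 ∷ []) ++ω u}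
        (λ { zero → refl ; (suc zero) → refl ; (suc (suc n)) → refl })
        (good-𝟘∷ ((𝟙 ∷ []) ++ω u) (good-𝟙∷ u (good-resp w≗0δωu good) u₀ h) refl))
      refl

    -- Since `u` begins with 0, either it begins with 001, or 1`u` begins with neither 11 nor 1001
    -- and 01`u` is good.
    split : ∀ a b → u 1 ≡ a → u 2 ≡ b →
            (((𝟘 ∷ 𝟙 ∷ []) ⁻¹· G[ 𝟘 ∷ 𝟙 ∷ [] ]) ∪ G[ 𝟘 ∷ 𝟘 ∷ 𝟙 ∷ [] ]) u
    split 𝟙 _ u₁ _  = inj₁ (01u λ e → contradiction (trans (sym u₁) e) λ ())
    split 𝟘 𝟘 _  u₂ = inj₁ (01u λ _ → u₂)
    split 𝟘 𝟙 u₁ u₂ = inj₂ (G[]⁺ (𝟘 ∷ 𝟘 ∷ 𝟙 ∷ []) good-u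
      (cong₂ _∷_ u₀ (cong₂ _∷_ u₁ (cong₂ _∷_ u₂ refl))))

  begins-001 : ∀ {w u} → w ≗ (𝟘 ∷ []) ++ω δω u → u 0 ≡ 𝟘 → w BeginsWith (𝟘 ∷ 𝟘 ∷ 𝟙 ∷ [])
  begins-001 {w} {u} e u₀ = cong₂ _∷_ (e 0) (cong₂ _∷_ (trans (e 1) (δω-even u 0))
    (cong₂ _∷_ (trans (e 2) (trans (δω-odd u 0) (cong not u₀))) refl))

  from : ∀ {w} → _ → G[ 𝟘 ∷ 𝟘 ∷ 𝟙 ∷ [] ] w
  from {w} (y , (u , u∈ , y≗δωu) , w≗0y) = helper u∈
    where
    w≗0δωu : w ≗ (𝟘 ∷ []) ++ω δω u
    w≗0δωu zero    = w≗0y 0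
    w≗0δωu (suc n) = trans (w≗0y (suc n)) (y≗δωu n)

    helper : (((𝟘 ∷ 𝟙 ∷ []) ⁻¹· G[ 𝟘 ∷ 𝟙 ∷ [] ]) ∪ G[ 𝟘 ∷ 𝟘 ∷ 𝟙 ∷ [] ]) u →
             G[ 𝟘 ∷ 𝟘 ∷ 𝟙 ∷ [] ] w
    -- As δ(01) = 0100, deleting three letters from the image of 01`u` leaves 0 `δω u`.
    helper (inj₁ (good , _)) = G[]⁺ (𝟘 ∷ 𝟘 ∷ 𝟙 ∷ [])
      (good-resp
        (λ n → trans (δω-++ω (𝟘 ∷ 𝟙 ∷ []) u (3 + n)) (sym (w≗0δωu n)))
        (good-drop (δω 01u) (good-δω good) 3))
      (begins-001 w≗0δωu (good⇒no11 (tail 01u) (good-tail 01u good) refl))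
      where 01u = (𝟘 ∷ 𝟙 ∷ []) ++ω u
    helper (inj₂ g) =
      let e = G[]⇒beginsWith (𝟘 ∷ 𝟘 ∷ 𝟙 ∷ []) g in
      G[]⁺ (𝟘 ∷ 𝟘 ∷ 𝟙 ∷ [])
        (good-resp (sym ∘ w≗0δωu) (001⇒good-𝟘∷δω u (proj₁ g) e))
        (begins-001 w≗0δωu (∷-injectiveˡ e))

G0001-equation : G[ 𝟘 ∷ 𝟘 ∷ 𝟘 ∷ 𝟙 ∷ [] ] ≐ δ[ G[ 𝟙 ∷ [] ] ]
G0001-equation = to , from
  where
  to : ∀ {w} → G[ 𝟘 ∷ 𝟘 ∷ 𝟘 ∷ 𝟙 ∷ [] ] w → δ[ G[ 𝟙 ∷ [] ] ] w
  to {w} g@(good , _) = u , G[]⁺ (𝟙 ∷ []) (good-δω⁻¹ (good-resp w≗δωu good))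
                                  (cong₂ _∷_ (cong not w₁) refl) , w≗δωu
    where
    e  = G[]⇒beginsWith (𝟘 ∷ 𝟘 ∷ 𝟘 ∷ 𝟙 ∷ []) g
    w₁ = ∷-injectiveˡ (∷-injectiveʳ e)
    w₂ = ∷-injectiveˡ (∷-injectiveʳ (∷-injectiveʳ e))
    w₃ = ∷-injectiveˡ (∷-injectiveʳ (∷-injectiveʳ (∷-injectiveʳ e)))
    u  = decode w

    w≗δωu : w ≗ δω u
    -- The one at position 3 forces zeros at all later even positions; positions 0 and 2 belong to
    -- the prefix 0001.
    w≗δωu = δω-decode λ
      { zero          → ∷-injectiveˡ e
      ; (suc zero)    → w₂
      ; (suc (suc m)) → good⇒noOddGap (drop 3 w) (good-drop w good 3) w₃ m }

  from : ∀ {w} → δ[ G[ 𝟙 ∷ [] ] ] w → G[ 𝟘 ∷ 𝟘 ∷ 𝟘 ∷ 𝟙 ∷ [] ] w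
  from {w} (u , g@(good , _) , w≗δωu) =
    G[]⁺ (𝟘 ∷ 𝟘 ∷ 𝟘 ∷ 𝟙 ∷ []) (good-resp (sym ∘ w≗δωu) (good-δω good))
      (trans (applyUpTo-≈ 4 (λ {k} _ → w≗δωu k))
             (δω-beginsWith (𝟙 ∷ 𝟘 ∷ []) {u}
               (cong₂ _∷_ u₀ (cong₂ _∷_ (good⇒no11 u good u₀) refl))))
    where u₀ = ∷-injectiveˡ (G[]⇒beginsWith (𝟙 ∷ []) g)

G1-equation : G[ 𝟙 ∷ [] ] ≐ ((𝟘 ∷ []) ⁻¹· G[ 𝟘 ∷ 𝟙 ∷ [] ])
G1-equation = to , from
  where
  to : ∀ {y} → G[ 𝟙 ∷ [] ] y → G[ 𝟘 ∷ 𝟙 ∷ [] ] ((𝟘 ∷ []) ++ω y)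
  to {y} g = G[]⁺ (𝟘 ∷ 𝟙 ∷ []) (good-𝟘∷ y (proj₁ g) (∷-injectiveˡ e)) (cong (𝟘 ∷_) e)
    where e = G[]⇒beginsWith (𝟙 ∷ []) g

  from : ∀ {y} → G[ 𝟘 ∷ 𝟙 ∷ [] ] ((𝟘 ∷ []) ++ω y) → G[ 𝟙 ∷ [] ] y
  from {y} g = G[]⁺ (𝟙 ∷ []) (good-tail ((𝟘 ∷ []) ++ω y) (proj₁ g))
    (∷-injectiveʳ (G[]⇒beginsWith (𝟘 ∷ 𝟙 ∷ []) g))

-- The stages of 01 • f

++ω-assoc : ∀ u v y → (u ++ v) ++ω y ≗ u ++ω v ++ω y
++ω-assoc []      v y n       = refl
++ω-assoc (a ∷ u) v y zero    = refl
++ω-assoc (a ∷ u) v y (suc n) = ++ω-assoc u v y n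

++ω-congʳ : ∀ u {x y} → x ≗ y → u ++ω x ≗ u ++ω y
++ω-congʳ []      e n       = e n
++ω-congʳ (a ∷ u) e zero    = refl
++ω-congʳ (a ∷ u) e (suc n) = ++ω-congʳ u e n

δω^ : ℕ → InfWord → InfWord
δω^ zero    y = y
δω^ (suc n) y = δω (δω^ n y)

δω^-cong : ∀ n {x y} → x ≗ y → δω^ n x ≗ δω^ n y
δω^-cong zero    e = e
δω^-cong (suc n) e = δω-cong (δω^-cong n e)

δω^-δω : ∀ n y → δω^ n (δω y) ≡ δω (δω^ n y)
δω^-δω zero    y = refl
δω^-δω (suc n) y = cong δω (δω^-δω n y)

δω^-++ω : ∀ n u y → δω^ n (u ++ω y) ≗ δ^ n u ++ω δω^ n y
δω^-++ω zero    u y k = refl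
δω^-++ω (suc n) u y k =
  trans (δω-cong (δω^-++ω n u y) k) (δω-++ω (δ^ n u) (δω^ n y) k)

δ-++ : ∀ u v → δ (u ++ v) ≡ δ u ++ δ v
δ-++ = concatMap-++ _

δ^-++ : ∀ n u v → δ^ n (u ++ v) ≡ δ^ n u ++ δ^ n v
δ^-++ zero    u v = refl
δ^-++ (suc n) u v = trans (cong δ (δ^-++ n u v)) (δ-++ (δ^ n u) (δ^ n v))

δ^-δ : ∀ n u → δ^ n (δ u) ≡ δ (δ^ n u)
δ^-δ zero    u = refl
δ^-δ (suc n) u = cong δ (δ^-δ n u)

length-δ : ∀ u → length (δ u) ≡ 2 * length u
length-δ []      = refl
length-δ (𝟘 ∷ u) = trans (cong (2 +_) (length-δ u)) (sym (*-suc 2 (length u)))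
length-δ (𝟙 ∷ u) = trans (cong (2 +_) (length-δ u)) (sym (*-suc 2 (length u)))

length-δ^ : ∀ n u → length (δ^ n u) ≡ 2 ^ n * length u
length-δ^ zero    u = sym (*-identityˡ (length u))
length-δ^ (suc n) u = trans (length-δ (δ^ n u))
  (trans (cong (2 *_) (length-δ^ n u)) (sym (*-assoc 2 (2 ^ n) (length u))))

not^ : ℕ → Letter → Letter
not^ zero    a = a
not^ (suc n) a = not (not^ n a)

not^-not : ∀ n a → not^ n (not a) ≢ not^ n a
not^-not zero    𝟘 ()
not^-not zero    𝟙 ()
not^-not (suc n) a e = not^-not n a
  (trans (sym (not-involutive _)) (trans (cong not e) (not-involutive _)))

-- The last letter of δ(b) is the complement of b, so each application of δ flips the last letter.
δ^-∷ʳ : ∀ n u a → ∃[ v ] δ^ n (u ∷ʳ a) ≡ v ∷ʳ not^ n a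
δ^-∷ʳ zero    u a = u , refl
δ^-∷ʳ (suc n) u a with v , e ← δ^-∷ʳ n u a =
  δ v ∷ʳ 𝟘 , trans (cong δ e) (trans (δ-++ v _) (δ-last (not^ n a)))
  where
  δ-last : ∀ b → δ v ++ δ (b ∷ []) ≡ (δ v ∷ʳ 𝟘) ∷ʳ not b
  δ-last 𝟘 = sym (++-assoc (δ v) _ _)
  δ-last 𝟙 = sym (++-assoc (δ v) _ _)

suffix⇒++ : ∀ {u w} → u SuffixOf w → ∃[ v ] w ≡ v ++ u
suffix⇒++ s with v Suffix.++ e ← Suffix.toView s = v , cong (v ++_) (sym (Pointwise-≡⇒≡ e))

++⇒suffix : ∀ v u → u SuffixOf (v ++ u)
++⇒suffix v u = Suffix.fromView (v Suffix.++ ≡⇒Pointwise-≡ refl)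

-- δⁿ(01) and δⁿ⁺¹(01) = δⁿ(0100) end in different letters, and for m ≥ n + 2
-- the word δᵐ(01) is longer than v δⁿ(01).
level-++-δ^ : ∀ n v → length v + 4 ≤ 4 * 2 ^ n → level (v ++ δ^ n 01-word) ≡ n
level-++-δ^ n v v-short with m≤n⇒m<n∨m≡n n≤L | level-suffix w n w-suffix
  where
  w = v ++ δ^ n 01-word
  w-suffix = ++⇒suffix v (δ^ n 01-word)
  n≤L = level-largest w n w-suffix
... | inj₂ n≡L | _ = sym n≡L
... | inj₁ n<L | s with m≤n⇒m<n∨m≡n n<L
...   | inj₂ 1+n≡L = ⊥-elim (not^-not n 𝟘 (sym last))
  where
  s′ : ∃[ u ] v ++ δ^ n 01-word ≡ u ++ δ^ n (𝟘 ∷ 𝟙 ∷ 𝟘 ∷ 𝟘 ∷ [])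
  s′ = suffix⇒++ (subst (_SuffixOf (v ++ δ^ n 01-word))
         (trans (cong (λ m → δ^ m 01-word) (sym 1+n≡L)) (sym (δ^-δ n 01-word))) s)

  last : not^ n 𝟘 ≡ not^ n 𝟙
  last with u , e ← s′ | x , p ← δ^-∷ʳ n (𝟘 ∷ []) 𝟙 | y , q ← δ^-∷ʳ n (𝟘 ∷ 𝟙 ∷ 𝟘 ∷ []) 𝟘 =
    ∷ʳ-injectiveʳ (u ++ y) (v ++ x) (begin
      (u ++ y) ∷ʳ not^ n 𝟘                ≡⟨ ++-assoc u y _ ⟩
      u ++ y ∷ʳ not^ n 𝟘                  ≡⟨ cong (u ++_) q ⟨
      u ++ δ^ n (𝟘 ∷ 𝟙 ∷ 𝟘 ∷ 𝟘 ∷ [])     ≡⟨ e ⟨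
      v ++ δ^ n 01-word                   ≡⟨ cong (v ++_) p ⟩
      v ++ x ∷ʳ not^ n 𝟙                  ≡⟨ ++-assoc v x _ ⟨
      (v ++ x) ∷ʳ not^ n 𝟙                ∎)
    where open ≡-Reasoning
...   | inj₁ 2+n≤L = ⊥-elim (<-irrefl refl (begin-strict
    length (v ++ δ^ n 01-word)           ≡⟨ length-++ v ⟩
    length v + length (δ^ n 01-word)     ≡⟨ cong (length v +_) (length-δ^ n 01-word) ⟩
    length v + 2 ^ n * 2                 <⟨ +-monoˡ-< (2 ^ n * 2) (m<m+n (length v) z<s) ⟩
    length v + 4 + 2 ^ n * 2             ≤⟨ +-monoˡ-≤ (2 ^ n * 2) v-short ⟩
    4 * 2 ^ n + 2 ^ n * 2                ≤⟨ m≤m+n _ (2 * 2 ^ n) ⟩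
    4 * 2 ^ n + 2 ^ n * 2 + 2 * 2 ^ n    ≡⟨ rearrange (2 ^ n) ⟩
    2 ^ (2 + n) * 2                      ≤⟨ *-monoˡ-≤ 2 (^-monoʳ-≤ 2 2+n≤L) ⟩
    2 ^ level (v ++ δ^ n 01-word) * 2    ≡⟨ length-δ^ (level (v ++ δ^ n 01-word)) 01-word ⟨
    length (δ^ (level (v ++ δ^ n 01-word)) 01-word) ≤⟨ length-mono s ⟩
    length (v ++ δ^ n 01-word)           ∎))
  where
  open ≤-Reasoning
  rearrange : ∀ t → 4 * t + t * 2 + 2 * t ≡ 2 * (2 * t) * 2
  rearrange = solve-∀

zeros : B → Word
zeros α = []
zeros β = 𝟘 ∷ []
zeros γ = 𝟘 ∷ 𝟘 ∷ []

-- Under δⁿ this says that appending δⁿ(`extension b`) turns a final δⁿ(01) into δⁿ⁺¹(0ᵉ01).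
δ-zeros-01 : ∀ b → δ (zeros b ++ 01-word) ≡ 01-word ++ extension b
δ-zeros-01 α = refl
δ-zeros-01 β = refl
δ-zeros-01 γ = refl

prefixes : (ℕ → B) → ℕ → Word
prefixes f zero    = []
prefixes f (suc n) = prefixes f n ++ δ^ (suc n) (zeros (f n))

-- The extreme case is `γ` throughout, where the blocks of lengths 2·2ⁱ for i = 1, ..., n add up to
-- 4·2ⁿ - 4. This is the bound under which `level-++-δ^` applies.
length-prefixes : ∀ f n → length (prefixes f n) + 4 ≤ 4 * 2 ^ n
length-prefixes f zero    = ≤-refl
length-prefixes f (suc n) = begin
  length (prefixes f n ++ δ^ (suc n) z) + 4              ≡⟨ cong (_+ 4) (length-++ (prefixes f n)) ⟩
  length (prefixes f n) + length (δ^ (suc n) z) + 4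
    ≡⟨ cong (λ l → length (prefixes f n) + l + 4) (length-δ^ (suc n) z) ⟩
  length (prefixes f n) + 2 ^ suc n * length z + 4
    ≤⟨ +-monoˡ-≤ 4 (+-monoʳ-≤ (length (prefixes f n))
         (*-monoʳ-≤ (2 ^ suc n) (length-zeros (f n)))) ⟩
  length (prefixes f n) + 2 ^ suc n * 2 + 4              ≡⟨ rearrange₁ (length (prefixes f n)) (2 ^ n) ⟩
  (length (prefixes f n) + 4) + 4 * 2 ^ n                ≤⟨ +-monoˡ-≤ (4 * 2 ^ n) (length-prefixes f n) ⟩
  4 * 2 ^ n + 4 * 2 ^ n                                  ≡⟨ rearrange₂ (2 ^ n) ⟩
  4 * 2 ^ suc n                                          ∎
  where
  open ≤-Reasoning
  z = zeros (f n)

  length-zeros : ∀ b → length (zeros b) ≤ 2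
  length-zeros α = z≤n
  length-zeros β = s≤s z≤n
  length-zeros γ = ≤-refl

  rearrange₁ : ∀ l t → l + 2 * t * 2 + 4 ≡ (l + 4) + 4 * t
  rearrange₁ = solve-∀

  rearrange₂ : ∀ t → 4 * t + 4 * t ≡ 4 * (2 * t)
  rearrange₂ = solve-∀

-- By the length bound the n-th stage has level exactly n, so the next operator appends
-- δⁿ(`extension b`).
stage-prefixes : ∀ f n → stage 01-word f n ≡ prefixes f n ++ δ^ n 01-word
stage-prefixes f zero    = refl
stage-prefixes f (suc n) = begin
  apply b (stage 01-word f n)                      ≡⟨ cong (apply b) (stage-prefixes f n) ⟩
  (p ++ δ^ n 01-word) ++ δ^ (level (p ++ δ^ n 01-word)) (extension b)
    ≡⟨ cong (λ l → (p ++ δ^ n 01-word) ++ δ^ l (extension b))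
            (level-++-δ^ n p (length-prefixes f n)) ⟩
  (p ++ δ^ n 01-word) ++ δ^ n (extension b)        ≡⟨ ++-assoc p _ _ ⟩
  p ++ δ^ n 01-word ++ δ^ n (extension b)          ≡⟨ cong (p ++_) (δ^-++ n 01-word (extension b)) ⟨
  p ++ δ^ n (01-word ++ extension b)               ≡⟨ cong (λ u → p ++ δ^ n u) (δ-zeros-01 b) ⟨
  p ++ δ^ n (δ (zeros b ++ 01-word))               ≡⟨ cong (p ++_) (δ^-δ n (zeros b ++ 01-word)) ⟩
  p ++ δ^ (suc n) (zeros b ++ 01-word)             ≡⟨ cong (p ++_) (δ^-++ (suc n) (zeros b) 01-word) ⟩
  p ++ δ^ (suc n) (zeros b) ++ δ^ (suc n) 01-word  ≡⟨ ++-assoc p _ _ ⟨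
  prefixes f (suc n) ++ δ^ (suc n) 01-word         ∎
  where
  open ≡-Reasoning
  b = f n
  p = prefixes f n

-- Iterated desubstitution of words in G₀₁

G₀₁ : Set
G₀₁ = ∃ G[ 𝟘 ∷ 𝟙 ∷ [] ]

-- Since `x` begins with 01 it is `δω u` with `u` good and beginning with 0. As 0000 is excluded,
-- the first 01 of `u` starts at position 0, 1 or 2, which selects `α`, `β` or `γ`.
desubstitute : (s : G₀₁) → ∃₂ λ b (t : G₀₁) → proj₁ s ≗ δω (zeros b ++ω proj₁ t)
desubstitute (x , g@(good , _)) = split (u 1) (u 2) refl refl
  where
  e  = G[]⇒beginsWith (𝟘 ∷ 𝟙 ∷ []) g
  x₁ = ∷-injectiveˡ (∷-injectiveʳ e)
  u  = decode x

  x≗δωu : x ≗ δω u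
  x≗δωu = good⇒δω x (good-tail x good) (∷-injectiveˡ e) x₁

  good-u : Good u
  good-u = good-δω⁻¹ (good-resp x≗δωu good)

  u₀ : u 0 ≡ 𝟘
  u₀ = cong not x₁

  rest : ∀ i → u (i + 0) ≡ 𝟘 → u (i + 1) ≡ 𝟙 → G₀₁
  rest i e₀ e₁ = drop i u ,
    G[]⁺ (𝟘 ∷ 𝟙 ∷ []) (good-drop u good-u i) (cong₂ _∷_ e₀ (cong₂ _∷_ e₁ refl))

  x≗ : ∀ w → u BeginsWith w → x ≗ δω (w ++ω drop (length w) u)
  x≗ w e n = trans (x≗δωu n) (δω-cong (beginsWith⇒≗ w e) n)

  split : ∀ a b → u 1 ≡ a → u 2 ≡ b →
          ∃₂ λ b (t : G₀₁) → x ≗ δω (zeros b ++ω proj₁ t)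
  split 𝟙 _ u₁ _  = α , rest 0 u₀ u₁ , x≗ [] refl
  split 𝟘 𝟙 u₁ u₂ = β , rest 1 u₁ u₂ , x≗ (𝟘 ∷ []) (cong₂ _∷_ u₀ refl)
  split 𝟘 𝟘 u₁ u₂ = γ , rest 2 u₂ (good⇒no0000 u good-u u₀ u₁ u₂) ,
    x≗ (𝟘 ∷ 𝟘 ∷ []) (cong₂ _∷_ u₀ (cong₂ _∷_ u₁ refl))

residual : G₀₁ → ℕ → G₀₁
residual s zero    = s
residual s (suc n) = proj₁ (proj₂ (desubstitute (residual s n)))

code : G₀₁ → ℕ → B
code s n = proj₁ (desubstitute (residual s n))

-- In each step the n-fold image of the residual is rewritten by `desubstitute`, and the image of
-- its leading zeros joins the prefix.
code-expansion : ∀ s n →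
  proj₁ s ≗ prefixes (code s) n ++ω δω^ n (proj₁ (residual s n))
code-expansion s zero    k = refl
code-expansion s (suc n) k = begin
  proj₁ s k                                          ≡⟨ code-expansion s n k ⟩
  (p ++ω δω^ n (proj₁ (residual s n))) k             ≡⟨ ++ω-congʳ p expand k ⟩
  (p ++ω δ^ (suc n) z ++ω δω^ (suc n) y) k           ≡⟨ ++ω-assoc p (δ^ (suc n) z) (δω^ (suc n) y) k ⟨
  ((p ++ δ^ (suc n) z) ++ω δω^ (suc n) y) k          ∎
  where
  open ≡-Reasoning
  p = prefixes (code s) n
  z = zeros (code s n)
  y = proj₁ (residual s (suc n))

  expand : δω^ n (proj₁ (residual s n)) ≗ δ^ (suc n) z ++ω δω^ (suc n) y
  expand j = begin
    δω^ n (proj₁ (residual s n)) j     ≡⟨ δω^-cong n (proj₂ (proj₂ (desubstitute (residual s n)))) j ⟩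
    δω^ n (δω (z ++ω y)) j             ≡⟨ cong (λ x → x j) (δω^-δω n (z ++ω y)) ⟩
    δω^ (suc n) (z ++ω y) j            ≡⟨ δω^-++ω (suc n) z y j ⟩
    (δ^ (suc n) z ++ω δω^ (suc n) y) j ∎

-- The residual itself begins with 01, which supplies the factor δⁿ(01) that completes the stage.
code-beginsWith : ∀ s n → proj₁ s BeginsWith stage 01-word (code s) n
code-beginsWith s n = subst (proj₁ s BeginsWith_) (sym (stage-prefixes (code s) n))
  (≗⇒beginsWith (p ++ δ^ n 01-word) expand)
  where
  p = prefixes (code s) n
  y = proj₁ (residual s n)

  expand : proj₁ s ≗ (p ++ δ^ n 01-word) ++ω δω^ n (drop 2 y)
  expand k = trans (code-expansion s n k) (trans
    (++ω-congʳ p (λ j → trans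
      (δω^-cong n (beginsWith⇒≗ 01-word
        (G[]⇒beginsWith (𝟘 ∷ 𝟙 ∷ []) (proj₂ (residual s n)))) j)
      (δω^-++ω n 01-word (drop 2 y) j)) k)
    (sym (++ω-assoc p (δ^ n 01-word) (δω^ n (drop 2 y)) k)))

≗-01•code : ∀ s → proj₁ s ≗ 01-word • code s
≗-01•code s k = applyUpTo-≈⁻¹ (length w)
  (trans (code-beginsWith s (suc k)) (sym (•-prefix 01-word (code s) (suc k))))
  -- Stage k + 1 has more than k letters, so agreement on it includes position k.
  (stage-length 01-word (code s) (suc k))
  where w = stage 01-word (code s) (suc k)

G01-equation : G[ 𝟘 ∷ 𝟙 ∷ [] ] ≐ ((𝟘 ∷ 𝟙 ∷ []) •[ W ])
G01-equation = to , from
  where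
  to : ∀ {x} → G[ 𝟘 ∷ 𝟙 ∷ [] ] x → ((𝟘 ∷ 𝟙 ∷ []) •[ W ]) x
  to {x} g = code s , good-resp (≗-01•code s) (proj₁ g) , ≗-01•code s
    where s = x , g

  from : ∀ {x} → ((𝟘 ∷ 𝟙 ∷ []) •[ W ]) x → G[ 𝟘 ∷ 𝟙 ∷ [] ] x
  from (f , good , e) = G[]⁺ (𝟘 ∷ 𝟙 ∷ []) (good-resp (sym ∘ e) good)
    (trans (applyUpTo-≈ 2 (λ {k} _ → e k)) (•-prefix 01-word f 0))

theorem3p7 : (G[ 𝟘 ∷ 𝟙 ∷ [] ] ≐ ((𝟘 ∷ 𝟙 ∷ []) •[ W ]))
    × (G[ 𝟘 ∷ 𝟘 ∷ 𝟙 ∷ [] ]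
    ≐ ((𝟘 ∷ []) · δ[ ((𝟘 ∷ 𝟙 ∷ []) ⁻¹· G[ 𝟘 ∷ 𝟙 ∷ [] ]) ∪ G[ 𝟘 ∷ 𝟘 ∷ 𝟙 ∷ [] ] ]))
    × (G[ 𝟘 ∷ 𝟘 ∷ 𝟘 ∷ 𝟙 ∷ [] ] ≐ δ[ G[ 𝟙 ∷ [] ] ])
    × (G[ 𝟙 ∷ [] ] ≐ ((𝟘 ∷ []) ⁻¹· G[ 𝟘 ∷ 𝟙 ∷ [] ]))
theorem3p7 = G01-equation , G001-equation , G0001-equation , G1-equation
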